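{- There are infinitely many finite sets of prime numbers that are MSTD sets.
   Context: For a finite set $S$ of integers, $S+S = \{x+y : x,y \in S\}$ and $S-S = \{x-y : x,y\in S\}$; $S$ is an MSTD (More Sums Than Differences) set if $|S+S| > |S-S|$. -}

module Defs where

open import Data.Nat using (ℕ; _<_; _+_)
open import Data.Nat.Primality using (Prime)
open import Data.Integer as ℤ using (ℤ; +_)
open import Data.List using (List; []; _∷_; length; map; concatMap; deduplicate)
open import Data.List.Relation.Unary.All using (All)
open import Data.List.Relation.Unary.Linked using (Linked)
import Data.Nat.Properties as ℕP
import Data.Integer.Properties as ℤP

-- A finite set of natural numbers is represented canonically by a
-- strictly increasing list (so two representations are equal iff the sets are).
FinSet : List ℕ → Set
FinSet S = Linked _<_ S

AllPrime : List ℕ → Set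
AllPrime S = All Prime S

sumList : List ℕ → List ℕ
sumList S = concatMap (λ x → map (λ y → x + y) S) S

diffList : List ℕ → List ℤ
diffList S = concatMap (λ x → map (λ y → (+ x) ℤ.- (+ y)) S) S

card+ : List ℕ → ℕ
card+ S = length (deduplicate ℕP._≟_ (sumList S))

card- : List ℕ → ℕ
card- S = length (deduplicate ℤP._≟_ (diffList S))

MSTD : List ℕ → Set
MSTD S = card- S < card+ S

{-# OPTIONS --safe #-}

-- If T is a finite set of naturals with |T+T| > |T-T| + |T|, then T ∪ {p} is an MSTD set
-- for every sufficiently large p: the new element contributes at least |T| new sums p + t
-- and at most 2|T| new differences ±(p - t).  So a single such set T of primes yields
-- infinitely many MSTD sets of primes, by letting p run over the large primes.
--
-- The set T₀ below has 193 elements, 3884 sums and 3645 differences.  It was found by simulated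
-- annealing on the subsets of the primes below 4000; most of the even numbers missing from
-- T₀ - T₀ are ≡ ±8 (mod 30), while T₀ + T₀ misses few even numbers.

module Submission where

open import Defs
open import Data.Integer as ℤ using ()
import Data.Integer.Properties as ℤ
open import Data.List using (List; []; _∷_; _++_; _∷ʳ_; length; map; concat; concatMap; foldr; merge; derun)
open import Data.List.Extrema.Nat using (max; ⊥≤max; xs≤max)
open import Data.List.Membership.Propositional using (_∈_; _∉_; lose; find)
open import Data.List.Membership.Propositional.Properties using (∈-∃++; ∈-++⁺ˡ; ∈-++⁺ʳ; ∈-++⁻; ∈-map⁺; ∈-map⁻; ∈-concat⁺′; ∈-concatMap⁺; ∈-concatMap⁻; ∈-derun⁺; ∈-derun⁻; ∈-deduplicate⁺; ∈-deduplicate⁻)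
open import Data.List.Properties using (length-++; length-map)
open import Data.List.Relation.Binary.Disjoint.Propositional using (Disjoint)
open import Data.List.Relation.Binary.Permutation.Propositional using (↭-sym)
open import Data.List.Relation.Binary.Permutation.Propositional.Properties using (∈-resp-↭; merge-↭)
open import Data.List.Relation.Binary.Subset.Propositional using (_⊆_)
open import Data.List.Relation.Unary.All as All using (All; []; _∷_; all?)
import Data.List.Relation.Unary.All.Properties as All
open import Data.List.Relation.Unary.AllPairs as AllPairs using ([]; _∷_)
import Data.List.Relation.Unary.AllPairs.Properties as AllPairs
open import Data.List.Relation.Unary.Any using (here; there)
open import Data.List.Relation.Unary.Linked using (Linked; linked?)
open import Data.List.Relation.Unary.Linked.Properties using (Linked⇒AllPairs; AllPairs⇒Linked)
open import Data.List.Relation.Unary.Unique.Propositional using (Unique)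
import Data.List.Relation.Unary.Unique.Propositional.Properties as Unique
import Data.List.Relation.Unary.Unique.DecPropositional.Properties as DecUnique
open import Data.Nat using (ℕ; suc; _+_; _*_; _∸_; _≤_; _<_; z≤n; s≤s; z<s; _≤?_; _<?_; _≟_; _!; >-nonZero; >-nonZero⁻¹; nonTrivial⇒≢1; n>1⇒nonTrivial; nonTrivial⇒n>1; _⊓_)
open import Data.Nat.Divisibility using (_∣_; _∤_; _∣?_; hasNonTrivialDivisor; ∣-trans; m∣m*n; m≤n⇒m!∣n!; ∣m+n∣m⇒∣n; ∣1⇒≡1)
open import Data.Nat.Primality using (Prime; rough∧square>⇒prime; prime⇒nonZero; prime⇒nonTrivial)
open import Data.Nat.Primality.Factorisation using (factorise)
open import Data.Nat.Properties
open import Data.Product using (∃; _×_; _,_)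
open import Data.Sum using (inj₁; inj₂)
open import Function using (_∘_; flip)
open import Relation.Binary.PropositionalEquality using (_≡_; refl; sym; trans; cong; cong₂; subst)
open import Relation.Nullary using (Dec; contradiction; ¬?; _×-dec_; _→-dec_)
open import Relation.Nullary.Decidable using (toWitness)

-- Counting by inclusion: a repetition-free list inside another list.

module _ {a} {A : Set a} where

  ⊆-remove : ∀ {x : A} {xs} as {bs} → x ∉ xs → xs ⊆ as ++ x ∷ bs → xs ⊆ as ++ bs
  ⊆-remove as x∉xs xs⊆ z∈xs with ∈-++⁻ as (xs⊆ z∈xs)
  ... | inj₁ z∈as         = ∈-++⁺ˡ z∈as
  ... | inj₂ (here refl)  = contradiction z∈xs x∉xs
  ... | inj₂ (there z∈bs) = ∈-++⁺ʳ as z∈bs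

  -- Induction on `xs`: striking one occurrence of the head out of `ys` leaves a list that still
  -- contains the tail, since the head does not recur there.
  Unique∧⊆⇒length≤ : ∀ {xs ys : List A} → Unique xs → xs ⊆ ys → length xs ≤ length ys
  Unique∧⊆⇒length≤ []                   xs⊆ys = z≤n
  Unique∧⊆⇒length≤ {x ∷ xs} u@(_ ∷ xs!) xs⊆ys with ∈-∃++ (xs⊆ys (here refl))
  ... | as , bs , refl = begin
    suc (length xs)               ≤⟨ s≤s (Unique∧⊆⇒length≤ xs! xs⊆as++bs) ⟩
    suc (length (as ++ bs))       ≡⟨ cong suc (length-++ as) ⟩
    suc (length as + length bs)   ≡⟨ +-suc (length as) (length bs) ⟨
    length as + length (x ∷ bs)   ≡⟨ length-++ as ⟨
    length (as ++ x ∷ bs)         ∎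
    where
    open ≤-Reasoning
    xs⊆as++bs : xs ⊆ as ++ bs
    xs⊆as++bs = ⊆-remove as (Unique.Unique[x∷xs]⇒x∉xs u) (xs⊆ys ∘ there)

-- Membership in sum and difference lists, and their sorted enumeration.

module _ {a b c} {A : Set a} {B : Set b} {C : Set c} (f : A → B → C) {xs : List A} {ys : List B} where

  ∈-concatMap-map⁺ : ∀ {x y} → x ∈ xs → y ∈ ys → f x y ∈ concatMap (λ x → map (f x) ys) xs
  ∈-concatMap-map⁺ x∈xs y∈ys = ∈-concatMap⁺ _ (lose x∈xs (∈-map⁺ _ y∈ys))

  ∈-concatMap-map⁻ : ∀ {z} → z ∈ concatMap (λ x → map (f x) ys) xs →
                     ∃ λ x → ∃ λ y → x ∈ xs × y ∈ ys × z ≡ f x y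
  ∈-concatMap-map⁻ z∈ with find (∈-concatMap⁻ _ z∈)
  ... | x , x∈xs , z∈map with ∈-map⁻ (f x) z∈map
  ...   | y , y∈ys , z≡fxy = x , y , x∈xs , y∈ys , z≡fxy

-- Without repetitions only if every map (f x) ys is increasing; merging instead of deduplicating
-- makes the evaluation on T₀ feasible.
sortedImage : (ℕ → ℕ → ℕ) → List ℕ → List ℕ → List ℕ
sortedImage f ys = foldr (λ x zs → derun _≟_ (merge _≤?_ (map (f x) ys) zs)) []

module _ (f : ℕ → ℕ → ℕ) (ys : List ℕ) where

  sortedImage⊆concatMap : ∀ xs → sortedImage f ys xs ⊆ concatMap (λ x → map (f x) ys) xs
  sortedImage⊆concatMap (x ∷ xs) z∈
    with ∈-++⁻ (map (f x) ys) (∈-resp-↭ (merge-↭ _≤?_ _ (sortedImage f ys xs)) (∈-derun⁻ _≟_ _ z∈))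
  ... | inj₁ z∈map  = ∈-++⁺ˡ z∈map
  ... | inj₂ z∈rest = ∈-++⁺ʳ _ (sortedImage⊆concatMap xs z∈rest)

  concatMap⊆sortedImage : ∀ xs → concatMap (λ x → map (f x) ys) xs ⊆ sortedImage f ys xs
  concatMap⊆sortedImage (x ∷ xs) z∈ =
    ∈-derun⁺ _≟_ (∈-resp-↭ (↭-sym (merge-↭ _≤?_ _ (sortedImage f ys xs))) z∈′)
    where
    z∈′ : _ ∈ map (f x) ys ++ sortedImage f ys xs
    z∈′ with ∈-++⁻ (map (f x) ys) z∈
    ... | inj₁ z∈map  = ∈-++⁺ˡ z∈map
    ... | inj₂ z∈rest = ∈-++⁺ʳ _ (concatMap⊆sortedImage xs z∈rest)

-- Bounds on the numbers of sums and differences, and the effect of adjoining `p`.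

length≤card+ : ∀ {K S} → Unique K → K ⊆ sumList S → length K ≤ card+ S
length≤card+ K! K⊆ = Unique∧⊆⇒length≤ K! (∈-deduplicate⁺ _≟_ ∘ K⊆)

-- `D` may repeat elements: that only weakens an upper bound.
card-≤length : ∀ {D} S → diffList S ⊆ D → card- S ≤ length D
card-≤length S ⊆D =
  Unique∧⊆⇒length≤ (DecUnique.deduplicate-! ℤ._≟_ (diffList S)) (⊆D ∘ ∈-deduplicate⁻ ℤ._≟_ (diffList S))

module _ {T K : List ℕ} {p : ℕ} (T! : Unique T) (K! : Unique K) (K⊆T+T : K ⊆ sumList T) (K<p : All (_< p) K) where

  sumList-mono-∷ʳ : sumList T ⊆ sumList (T ∷ʳ p)
  sumList-mono-∷ʳ z∈ with ∈-concatMap-map⁻ _+_ {T} z∈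
  ... | x , y , x∈T , y∈T , refl = ∈-concatMap-map⁺ _+_ (∈-++⁺ˡ x∈T) (∈-++⁺ˡ y∈T)

  -- The sums `p + t` are pairwise distinct by cancellation, and being at least `p` they exceed
  -- every element of `K`.
  length≤card+-∷ʳ : length K + length T ≤ card+ (T ∷ʳ p)
  length≤card+-∷ʳ = begin
    length K + length T                 ≡⟨ cong (_ +_) (length-map (p +_) T) ⟨
    length K + length (map (p +_) T)    ≡⟨ length-++ K ⟨
    length (K ++ map (p +_) T)          ≤⟨ length≤card+ {S = T ∷ʳ p} unique sums ⟩
    card+ (T ∷ʳ p)                      ∎
    where
    open ≤-Reasoning
    disjoint : Disjoint K (map (p +_) T)
    disjoint (z∈K , z∈p+T) with ∈-map⁻ (p +_) z∈p+T
    ... | t , _ , refl = <⇒≱ (All.lookup K<p z∈K) (m≤m+n p t)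
    unique : Unique (K ++ map (p +_) T)
    unique = Unique.++⁺ K! (Unique.map⁺ (+-cancelˡ-≡ p _ _) T!) disjoint
    sums : K ++ map (p +_) T ⊆ sumList (T ∷ʳ p)
    sums z∈ with ∈-++⁻ K z∈
    ... | inj₁ z∈K   = sumList-mono-∷ʳ (K⊆T+T z∈K)
    ... | inj₂ z∈p+T with ∈-map⁻ (p +_) z∈p+T
    ...   | t , t∈T , refl = ∈-concatMap-map⁺ _+_ (∈-++⁺ʳ T (here refl)) (∈-++⁺ˡ t∈T)

module _ {T D : List ℕ} (p : ℕ) (0∈D : 0 ∈ D) (T∸T⊆D : ∀ {x y} → x ∈ T → y ∈ T → x ∸ y ∈ D) where

  private
    new : List ℕ
    new = D ++ map (p ∸_) T

  -- Every difference is plus or minus a truncated one. Those within `T` lie in `D`, and the only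
  -- others are the `p ∸ t`. The factor 2 counts both signs, so 0 is counted more than once.
  card-∷ʳ≤length : All (_≤ p) T → card- (T ∷ʳ p) ≤ 2 * (length D + length T)
  card-∷ʳ≤length T≤p = begin
    card- (T ∷ʳ p)                                     ≤⟨ card-≤length (T ∷ʳ p) differences ⟩
    length (map ℤ.+_ new ++ map (ℤ.-_ ∘ ℤ.+_) new)         ≡⟨ length-++ (map ℤ.+_ new) ⟩
    length (map ℤ.+_ new) + length (map (ℤ.-_ ∘ ℤ.+_) new) ≡⟨ cong₂ _+_ (length-map _ new) (length-map _ new) ⟩
    length new + length new                            ≡⟨ cong (length new +_) (+-identityʳ (length new)) ⟨
    2 * length new                                     ≡⟨ cong (2 *_) (trans (length-++ D) (cong (_ +_) (length-map _ T))) ⟩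
    2 * (length D + length T)                          ∎
    where
    open ≤-Reasoning
    ∸∈new : ∀ {x y} → x ∈ T ∷ʳ p → y ∈ T ∷ʳ p → x ∸ y ∈ new
    ∸∈new x∈ y∈ with ∈-++⁻ T x∈ | ∈-++⁻ T y∈
    ... | inj₁ x∈T         | inj₁ y∈T         = ∈-++⁺ˡ (T∸T⊆D x∈T y∈T)
    -- Here `y` is `p`, and truncation sends `x ∸ p` to 0.
    ... | inj₁ x∈T         | inj₂ (here refl) = ∈-++⁺ˡ (subst (_∈ D) (sym (m≤n⇒m∸n≡0 (All.lookup T≤p x∈T))) 0∈D)
    ... | inj₂ (here refl) | inj₁ y∈T         = ∈-++⁺ʳ D (∈-map⁺ (p ∸_) y∈T)
    ... | inj₂ (here refl) | inj₂ (here refl) = ∈-++⁺ˡ (subst (_∈ D) (sym (n∸n≡0 p)) 0∈D)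
    difference : ∀ {x y} → x ∈ T ∷ʳ p → y ∈ T ∷ʳ p → ℤ.+ x ℤ.- ℤ.+ y ∈ map ℤ.+_ new ++ map (ℤ.-_ ∘ ℤ.+_) new
    difference {x} {y} x∈ y∈ rewrite ℤ.m-n≡m⊖n x y with ≤-total y x
    ... | inj₁ y≤x rewrite ℤ.⊖-≥ y≤x = ∈-++⁺ˡ (∈-map⁺ ℤ.+_ (∸∈new x∈ y∈))
    ... | inj₂ x≤y rewrite ℤ.⊖-≤ x≤y = ∈-++⁺ʳ (map ℤ.+_ new) (∈-map⁺ (ℤ.-_ ∘ ℤ.+_) (∸∈new y∈ x∈))
    differences : diffList (T ∷ʳ p) ⊆ map ℤ.+_ new ++ map (ℤ.-_ ∘ ℤ.+_) new
    differences z∈ with ∈-concatMap-map⁻ (λ x y → ℤ.+ x ℤ.- ℤ.+ y) {T ∷ʳ p} z∈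
    ... | x , y , x∈ , y∈ , refl = difference x∈ y∈

MSTD-∷ʳ : ∀ {T K D p} → Unique T → Unique K → K ⊆ sumList T → All (_< p) K →
          0 ∈ D → (∀ {x y} → x ∈ T → y ∈ T → x ∸ y ∈ D) → All (_≤ p) T →
          2 * length D + length T < length K → MSTD (T ∷ʳ p)
MSTD-∷ʳ {T} {K} {D} {p} T! K! K⊆ K<p 0∈D T∸T⊆D T≤p D+T<K = begin-strict
  card- (T ∷ʳ p)                         ≤⟨ card-∷ʳ≤length p 0∈D T∸T⊆D T≤p ⟩
  2 * (length D + length T)              ≡⟨ *-distribˡ-+ 2 (length D) (length T) ⟩
  2 * length D + 2 * length T            ≡⟨ cong (λ k → 2 * length D + (length T + k)) (+-identityʳ (length T)) ⟩
  2 * length D + (length T + length T)   ≡⟨ +-assoc (2 * length D) (length T) (length T) ⟨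
  2 * length D + length T + length T     <⟨ +-monoˡ-< (length T) D+T<K ⟩
  length K + length T                    ≤⟨ length≤card+-∷ʳ T! K! K⊆ K<p ⟩
  card+ (T ∷ʳ p)                         ∎
  where open ≤-Reasoning

Linked-<⇒Unique : ∀ {xs} → Linked _<_ xs → Unique xs
Linked-<⇒Unique = AllPairs.map <⇒≢ ∘ Linked⇒AllPairs <-trans

FinSet-∷ʳ : ∀ {T p} → FinSet T → All (_< p) T → FinSet (T ∷ʳ p)
FinSet-∷ʳ T< T<p = AllPairs⇒Linked (AllPairs.++⁺ (Linked⇒AllPairs <-trans T<) ([] ∷ []) (All.map (_∷ []) T<p))

-- Primality by trial division, and Euclid's theorem.

TrialDivision : ℕ → ℕ → Set
TrialDivision k n = 1 < n × n < k * k × (∀ {d} → d < k → 1 < d → d ∤ n)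

trialDivision? : ∀ k n → Dec (TrialDivision k n)
trialDivision? k n = 1 <? n ×-dec n <? k * k ×-dec allUpTo? (λ d → 1 <? d →-dec ¬? (d ∣? n)) k

-- A composite `n < k * k` has a divisor `d` with `1 < d < k`. Taking `k = 64` reaches every `n`
-- below 4096.
trialDivision⇒prime : ∀ {k n} → TrialDivision k n → Prime n
trialDivision⇒prime (1<n , n<k² , no-divisor) = rough∧square>⇒prime {{n>1⇒nonTrivial 1<n}}
  (λ (hasNonTrivialDivisor d<k d∣n) → no-divisor d<k (nonTrivial⇒n>1 _) d∣n) n<k²

∃-primeDivisor : ∀ {n} → 1 < n → ∃ λ p → Prime p × p ∣ n
∃-primeDivisor {n} 1<n with factorise n {{>-nonZero (<-trans z<s 1<n)}}
... | record { factors = [] ; isFactorisation = refl } = contradiction 1<n (<-irrefl refl)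
... | record { factors = p ∷ ps ; isFactorisation = refl ; factorsPrime = p-prime ∷ _ } =
  p , p-prime , m∣m*n _

∣-! : ∀ {m n} → 0 < m → m ≤ n → m ∣ n !
∣-! {suc m} _ m≤n = ∣-trans (m∣m*n (m !)) (m≤n⇒m!∣n! m≤n)

-- Euclid's argument: a prime divisor of `n ! + 1` that is at most `n` would divide `n !`, hence 1.
∃-prime> : ∀ n → ∃ λ p → Prime p × n < p
∃-prime> n with ∃-primeDivisor (+-monoˡ-≤ 1 (1≤n! n))
... | p , p-prime , p∣n!+1 = p , p-prime , ≰⇒> λ p≤n →
  contradiction (∣1⇒≡1 (∣m+n∣m⇒∣n p∣n!+1 (∣-! (>-nonZero⁻¹ p) p≤n))) nonTrivial⇒≢1
  where instance
    _ = prime⇒nonZero p-prime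
    _ = prime⇒nonTrivial p-prime

-- With `flip` the subtrahend is fixed in each row, so the rows increase weakly along an increasing
-- `T`, as merging requires. The leading 0 makes `0 ∈ differences T` immediate for every `T`.
sums differences : List ℕ → List ℕ
sums T        = sortedImage _+_ T T
differences T = 0 ∷ sortedImage (flip _∸_) T T

-- Infinitude is expressed by saying that no finite list `L` of sets is exhaustive.
infinitely-many-MSTD : ∀ {T bound} → FinSet T → AllPrime T → All (_< bound) T → Linked _<_ (sums T) →
  2 * length (differences T) + length T < length (sums T) →
  (L : List (List ℕ)) → ∃ λ S → FinSet S × AllPrime S × MSTD S × S ∉ L
infinitely-many-MSTD {T} {bound} T-increasing T-prime T-bounded sums-increasing surplus L
  -- Exceeding `bound + bound` puts `p` above all sums from `T`; exceeding every entry of `concat L`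
  -- ensures that no set in `L` contains `p`.
  with ∃-prime> (max (bound + bound) (concat L))
... | p , p-prime , max<p =
  T ∷ʳ p ,
  FinSet-∷ʳ T-increasing T<p ,
  All.++⁺ T-prime (p-prime ∷ []) ,
  MSTD-∷ʳ (Linked-<⇒Unique T-increasing) (Linked-<⇒Unique sums-increasing)
    (sortedImage⊆concatMap _+_ T T) (All.tabulate sum<p)
    (here refl) ∸∈differences (All.map <⇒≤ T<p) surplus ,
  λ S∈L → <⇒≱ max<p (All.lookup (xs≤max _ (concat L)) (∈-concat⁺′ (∈-++⁺ʳ T (here refl)) S∈L))
  where
  2bound<p : bound + bound < p
  2bound<p = ≤-<-trans (⊥≤max _ (concat L)) max<p
  T<p : All (_< p) T
  T<p = All.map (λ t<bound → <-trans t<bound (≤-<-trans (m≤m+n bound bound) 2bound<p)) T-bounded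
  sum<p : ∀ {z} → z ∈ sums T → z < p
  sum<p z∈ with ∈-concatMap-map⁻ _+_ {T} (sortedImage⊆concatMap _+_ T T z∈)
  ... | x , y , x∈T , y∈T , refl =
    <-trans (+-mono-< (All.lookup T-bounded x∈T) (All.lookup T-bounded y∈T)) 2bound<p
  ∸∈differences : ∀ {x y} → x ∈ T → y ∈ T → x ∸ y ∈ differences T
  ∸∈differences x∈T y∈T = there (concatMap⊆sortedImage (flip _∸_) T T (∈-concatMap-map⁺ (flip _∸_) y∈T x∈T))

-- The explicit set of primes, checked by evaluating decision procedures.

T₀ : List ℕ
T₀ =
  7 ∷ 13 ∷ 17 ∷ 29 ∷ 31 ∷ 41 ∷ 43 ∷ 47 ∷ 59 ∷ 61 ∷ 67 ∷ 71 ∷ 73 ∷ 83 ∷ 113 ∷ 131 ∷ 149 ∷ 151 ∷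
  163 ∷ 179 ∷ 181 ∷ 191 ∷ 193 ∷ 197 ∷ 211 ∷ 223 ∷ 227 ∷ 239 ∷ 263 ∷ 269 ∷ 271 ∷ 277 ∷ 281 ∷
  293 ∷ 331 ∷ 337 ∷ 359 ∷ 401 ∷ 431 ∷ 463 ∷ 487 ∷ 521 ∷ 523 ∷ 541 ∷ 547 ∷ 557 ∷ 571 ∷ 607 ∷
  617 ∷ 631 ∷ 641 ∷ 643 ∷ 661 ∷ 701 ∷ 733 ∷ 797 ∷ 811 ∷ 823 ∷ 857 ∷ 881 ∷ 947 ∷ 991 ∷ 1033 ∷
  1061 ∷ 1063 ∷ 1097 ∷ 1123 ∷ 1153 ∷ 1187 ∷ 1201 ∷ 1213 ∷ 1217 ∷ 1231 ∷ 1277 ∷ 1301 ∷ 1303 ∷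
  1367 ∷ 1381 ∷ 1423 ∷ 1481 ∷ 1487 ∷ 1511 ∷ 1543 ∷ 1621 ∷ 1637 ∷ 1663 ∷ 1693 ∷ 1697 ∷ 1721 ∷
  1741 ∷ 1753 ∷ 1783 ∷ 1787 ∷ 1847 ∷ 1871 ∷ 1901 ∷ 1907 ∷ 1951 ∷ 1993 ∷ 1997 ∷ 2053 ∷ 2081 ∷
  2087 ∷ 2113 ∷ 2131 ∷ 2143 ∷ 2161 ∷ 2267 ∷ 2297 ∷ 2311 ∷ 2357 ∷ 2383 ∷ 2411 ∷ 2417 ∷ 2441 ∷
  2473 ∷ 2477 ∷ 2503 ∷ 2521 ∷ 2551 ∷ 2591 ∷ 2593 ∷ 2621 ∷ 2713 ∷ 2731 ∷ 2777 ∷ 2801 ∷ 2833 ∷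
  2837 ∷ 2897 ∷ 2927 ∷ 2953 ∷ 2957 ∷ 2971 ∷ 3041 ∷ 3121 ∷ 3137 ∷ 3163 ∷ 3191 ∷ 3221 ∷ 3253 ∷
  3257 ∷ 3301 ∷ 3329 ∷ 3343 ∷ 3347 ∷ 3361 ∷ 3371 ∷ 3373 ∷ 3389 ∷ 3449 ∷ 3457 ∷ 3461 ∷ 3511 ∷
  3529 ∷ 3541 ∷ 3547 ∷ 3557 ∷ 3581 ∷ 3583 ∷ 3607 ∷ 3613 ∷ 3617 ∷ 3637 ∷ 3643 ∷ 3659 ∷ 3691 ∷
  3697 ∷ 3701 ∷ 3709 ∷ 3719 ∷ 3727 ∷ 3739 ∷ 3761 ∷ 3767 ∷ 3769 ∷ 3779 ∷ 3793 ∷ 3797 ∷ 3821 ∷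
  3847 ∷ 3851 ∷ 3853 ∷ 3877 ∷ 3881 ∷ 3907 ∷ 3911 ∷ 3917 ∷ 3919 ∷ 3929 ∷ 3931 ∷ 3943 ∷ 3947 ∷
  []

T₀-increasing : FinSet T₀
T₀-increasing = toWitness {a? = linked? _<?_ T₀} _

-- The cap n ⊓ 64 keeps a prime n < 64 from being tested against itself.
T₀-prime : AllPrime T₀
T₀-prime = All.map trialDivision⇒prime (toWitness {a? = all? (λ n → trialDivision? (n ⊓ 64) n) T₀} _)

T₀-bounded : All (_< 4000) T₀
T₀-bounded = toWitness {a? = all? (_<? 4000) T₀} _

-- This check replaces a general proof that merging keeps the order; it shows that `sums T₀` has no
-- repetitions.
sums-T₀-increasing : Linked _<_ (sums T₀)
sums-T₀-increasing = toWitness {a? = linked? _<?_ (sums T₀)} _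

-- `differences T₀` has 1824 entries, the 1822 positive differences and 0 twice, so the inequality
-- reads 2 * 1824 + 193 = 3841 < 3884.
T₀-surplus : 2 * length (differences T₀) + length T₀ < length (sums T₀)
T₀-surplus = toWitness {a? = 2 * length (differences T₀) + length T₀ <? length (sums T₀)} _

theorem1p4 : (L : List (List ℕ)) →
    ∃ λ S → FinSet S × AllPrime S × MSTD S × S ∉ L
theorem1p4 = infinitely-many-MSTD T₀-increasing T₀-prime T₀-bounded sums-T₀-increasing T₀-surplus
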